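{- Let $G$ and $H$ be two graphs. If $G$ is an efficient open domination graph and $|V(H)|\ge \Delta(H)+2\delta(H)+3$, then $$\gamma_R^p(G\circ H)=\gamma_t(G)(2+\delta(H)).$$
   Context: All graphs are finite, simple and undirected, with at least one vertex. $\delta(H)$ and $\Delta(H)$ are the minimum and maximum degrees of $H$; $N(v)$ is the open neighbourhood of $v$. $G$ is an efficient open domination graph if there is a set $D\subseteq V(G)$ with $V(G)=\bigcup_{u\in D}N(u)$ and $N(u)\cap N(v)=\varnothing$ for all distinct $u,v\in D$ (such a $G$ has no isolated vertices). For $G$ without isolated vertices, $\gamma_t(G)$ is the minimum size of a total dominating set, i.e. a set $S\subseteq V(G)$ such that every vertex of $G$ has a neighbour in $S$. A perfect Roman dominating function (PRDF) on a graph $\Gamma$ is a function $f:V(\Gamma)\to\{0,1,2\}$ such that every vertex $u$ with $f(u)=0$ is adjacent to exactly one vertex $v$ with $f(v)=2$. Its weight is $\sum_v f(v)$, and $\gamma_R^p(\Gamma)$ is the minimum weight of a PRDF on $\Gamma$. The lexicographic product $G\circ H$ has vertex set $V(G)\times V(H)$, with $(u,v)$ adjacent to $(x,y)$ iff $ux\in E(G)$, or $u=x$ and $vy\in E(H)$. -}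

module Defs where

open import Algebra.Properties.CommutativeMonoid.Sum using (sum; sum-cong-≗)
open import Data.Bool.Base using (Bool; true; T; if_then_else_)
open import Data.Bool.Properties using (T?)
open import Data.Fin.Base using (Fin; toℕ; finToFun; funToFin)
import Data.Fin.Properties as Fin
open import Data.Fin.Patterns using (0F; 1F; 2F)
open import Data.List.Base using (List; tabulate; map)
open import Data.List.Extrema.Nat using (min; max)
open import Data.Nat.Base using (ℕ; zero; suc; _*_; _^_; _≤_; z≤n; s≤s)
import Data.Nat.Properties as ℕ
open import Data.Product.Base using (∃; _×_; _,_; proj₁; proj₂)
open import Data.Product using (∃!)
open import Data.Product.Function.NonDependent.Propositional using (_×-↔_)
open import Data.Sum.Base using (_⊎_; inj₁; inj₂)
import Data.Sum.Base as Sum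
open import Data.Unit.Base using (tt)
open import Function.Base using (_∘_)
open import Function.Bundles using (_↔_; Inverse)
open import Function.Construct.Identity using (↔-id)
open import Function.Construct.Composition using (_↔-∘_)
open import Function.Properties.Inverse using (↔-sym; ↔⇒↣)
open import Level using (0ℓ)
open import Relation.Binary.Core using (Rel)
open import Relation.Binary.Definitions
  using (Symmetric; Irreflexive; DecidableEquality; _Respects_)
  renaming (Decidable to Decidable₂)
open import Relation.Binary.PropositionalEquality
  using (_≡_; _≢_; _≗_; refl; sym; trans; cong; subst)
open import Relation.Nullary.Decidable
  using (Dec; yes; no; ⌊_⌋; map′; toWitness; via-injection; _×-dec_; _⊎-dec_; _→-dec_)
open import Relation.Nullary.Negation.Core using (¬_; contradiction)
open import Relation.Unary using (Pred; Decidable)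

private variable
  A B : Set

record Graph : Set₁ where
  infix 4 _~_ _~?_
  field
    V        : Set
    order    : ℕ
    enum     : Fin order ↔ V
    vertex   : V                  -- graphs have at least one vertex
    _~_      : Rel V 0ℓ
    _~?_     : Decidable₂ _~_
    ~-sym    : Symmetric _~_
    ~-irrefl : Irreflexive _≡_ _~_

------------------------------------------------------------------------
-- Finite types

≡-dec : ∀ {n} → Fin n ↔ A → DecidableEquality A
≡-dec e = via-injection (↔⇒↣ (↔-sym e)) Fin._≟_

any? : ∀ {n} → Fin n ↔ A → {P : Pred A 0ℓ} → Decidable P → Dec (∃ P)
any? e {P} P? = map′
  (λ (i , p) → to i , p)
  (λ (x , p) → from x , subst P (sym (strictlyInverseˡ x)) p)
  (Fin.any? (P? ∘ to))
  where open Inverse e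

all? : ∀ {n} → Fin n ↔ A → {P : Pred A 0ℓ} → Decidable P → Dec (∀ x → P x)
all? e {P} P? = map′
  (λ p x → subst P (strictlyInverseˡ x) (p (from x)))
  (λ p i → p (to i))
  (Fin.all? (P? ∘ to))
  where open Inverse e

-- Decidability over the function space A → B needs the predicate to respect
-- pointwise equality, since function extensionality is unavailable.
anyFun? : ∀ {m n} → Fin m ↔ A → Fin n ↔ B → {P : Pred (A → B) 0ℓ} →
          P Respects _≗_ → Decidable P → Dec (∃ P)
anyFun? {A = A} {B = B} {m} {n} a b {P} resp P? = map′
  (λ (i , p) → decode i , p)
  (λ (f , p) → encode f , resp (λ x → sym (decode-encode f x)) p)
  (Fin.any? (P? ∘ decode))
  where
  module α = Inverse a
  module β = Inverse b

  decode : Fin (n ^ m) → (A → B)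
  decode i = β.to ∘ finToFun i ∘ α.from

  encode : (A → B) → Fin (n ^ m)
  encode f = funToFin (β.from ∘ f ∘ α.to)

  decode-encode : ∀ f → decode (encode f) ≗ f
  decode-encode f x =
    trans (cong β.to (Fin.finToFun-funToFin (β.from ∘ f ∘ α.to) (α.from x)))
    (trans (β.strictlyInverseˡ _) (cong f (α.strictlyInverseˡ x)))

------------------------------------------------------------------------
-- Minima

IsMinimum : Pred A 0ℓ → (A → ℕ) → Pred ℕ 0ℓ
IsMinimum P w k = (∃ λ x → P x × w x ≡ k) × (∀ x → P x → k ≤ w x)

leastℕ : {P : Pred ℕ 0ℓ} → Decidable P → ∀ n → P n →
         ∃ λ k → P k × (∀ j → P j → k ≤ j)
leastℕ P? n p with P? zero
... | yes p₀ = zero , p₀ , λ _ _ → z≤n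
leastℕ P? zero    p | no ¬p₀ = contradiction p ¬p₀
leastℕ P? (suc n) p | no ¬p₀ with leastℕ (P? ∘ suc) n p
... | k , pₖ , least = suc k , pₖ , λ
  { zero    p₀ → contradiction p₀ ¬p₀
  ; (suc j) pⱼ → s≤s (least j pⱼ) }

minimum-exists : ∀ {m n} → Fin m ↔ A → Fin n ↔ B →
                 {P : Pred (A → B) 0ℓ} → P Respects _≗_ → Decidable P →
                 (w : (A → B) → ℕ) → (∀ {f g} → f ≗ g → w f ≡ w g) →
                 ∃ P → ∃ (IsMinimum P w)
minimum-exists a b {P} resp P? w w-cong (f , p)
  with leastℕ (λ k → anyFun? a b {λ g → P g × w g ≡ k}
                 (λ g≗h (q , e) → resp g≗h q , trans (sym (w-cong g≗h)) e)
                 (λ g → P? g ×-dec (w g ℕ.≟ k)))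
              (w f) (f , p , refl)
... | k , attained , least = k , attained , λ g q → least (w g) (g , q , refl)

------------------------------------------------------------------------
-- Graph parameters

infix 4 _∈_
_∈_ : A → (A → Bool) → Set
x ∈ S = T (S x)

module _ (Γ : Graph) where
  open Graph Γ

  ∑ : (V → ℕ) → ℕ
  ∑ f = sum ℕ.+-0-commutativeMonoid (f ∘ Inverse.to enum)

  ∑-cong : ∀ {f g} → f ≗ g → ∑ f ≡ ∑ g
  ∑-cong f≗g = sum-cong-≗ ℕ.+-0-commutativeMonoid (f≗g ∘ Inverse.to enum)

  VertexSet : Set
  VertexSet = V → Bool

  size : VertexSet → ℕ
  size S = ∑ (λ v → if S v then 1 else 0)

  N : V → VertexSet
  N v w = ⌊ v ~? w ⌋

  degree : V → ℕ
  degree v = size (N v)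

  vertices : List V
  vertices = tabulate (Inverse.to enum)

  -- The first argument of min and max is the bound used for an empty list;
  -- here it is itself the degree of a vertex.
  δ Δ : ℕ
  δ = min (degree vertex) (map degree vertices)
  Δ = max (degree vertex) (map degree vertices)

  IsEfficientOpenDominating : Pred VertexSet 0ℓ
  IsEfficientOpenDominating D =
    (∀ v → ∃ λ u → u ∈ D × v ∈ N u) ×
    (∀ u v → u ∈ D → v ∈ D → u ≢ v → ∀ x → ¬ (x ∈ N u × x ∈ N v))

  EfficientOpenDomination : Set
  EfficientOpenDomination = ∃ IsEfficientOpenDominating

  NoIsolatedVertices : Set
  NoIsolatedVertices = ∀ v → ∃ λ u → v ~ u

  efficientOpenDomination⇒noIsolatedVertices :
    EfficientOpenDomination → NoIsolatedVertices
  efficientOpenDomination⇒noIsolatedVertices (_ , cover , _) v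
    with cover v
  ... | u , _ , v∈Nu = u , ~-sym (toWitness {a? = u ~? v} v∈Nu)

  IsTotalDominating : Pred VertexSet 0ℓ
  IsTotalDominating S = ∀ v → ∃ λ u → v ~ u × u ∈ S

  total-domination-number-exists :
    NoIsolatedVertices → ∃ (IsMinimum IsTotalDominating size)
  total-domination-number-exists noIsolated =
    minimum-exists enum Fin.2↔Bool resp dec size
      (λ S≗R → ∑-cong (λ v → cong (if_then 1 else 0) (S≗R v)))
      ((λ _ → true) , λ v → let u , v~u = noIsolated v in u , v~u , tt)
    where
    resp : IsTotalDominating Respects _≗_
    resp S≗R dom v = let u , v~u , u∈S = dom v in u , v~u , subst T (S≗R u) u∈S

    dec : Decidable IsTotalDominating
    dec S = all? enum λ v → any? enum λ u → (v ~? u) ×-dec T? (S u)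

  γₜ : NoIsolatedVertices → ℕ
  γₜ noIsolated = proj₁ (total-domination-number-exists noIsolated)

  IsPRDF : Pred (V → Fin 3) 0ℓ
  IsPRDF f = ∀ u → f u ≡ 0F → ∃! _≡_ λ v → u ~ v × f v ≡ 2F

  weight : (V → Fin 3) → ℕ
  weight f = ∑ (toℕ ∘ f)

  perfect-Roman-domination-number-exists : ∃ (IsMinimum IsPRDF weight)
  perfect-Roman-domination-number-exists =
    minimum-exists enum (↔-id (Fin 3)) resp dec weight
      (λ f≗g → ∑-cong (cong toℕ ∘ f≗g))
      ((λ _ → 1F) , λ _ ())
    where
    resp : IsPRDF Respects _≗_
    resp f≗g prdf u gu≡0 with prdf u (trans (f≗g u) gu≡0)
    ... | v , (u~v , fv≡2) , unique =
      v , (u~v , trans (sym (f≗g v)) fv≡2) ,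
      λ {w} (u~w , gw≡2) → unique (u~w , trans (f≗g w) gw≡2)

    dec : Decidable IsPRDF
    dec f = all? enum λ u → (f u Fin.≟ 0F) →-dec
      any? enum λ v → Q? u v ×-dec
        map′ (λ h {y} → h y) (λ h y → h {y})
             (all? enum λ y → Q? u y →-dec ≡-dec enum v y)
      where
      Q? : ∀ u v → Dec (u ~ v × f v ≡ 2F)
      Q? u v = (u ~? v) ×-dec (f v Fin.≟ 2F)

  γᵖR : ℕ
  γᵖR = proj₁ perfect-Roman-domination-number-exists

------------------------------------------------------------------------
-- Lexicographic product

infixl 7 _∘ₗ_

_∘ₗ_ : Graph → Graph → Graph
G ∘ₗ H = record
  { V        = G.V × H.V
  ; order    = G.order * H.order
  ; enum     = (G.enum ×-↔ H.enum) ↔-∘ Fin.*↔×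
  ; vertex   = G.vertex , H.vertex
  ; _~_      = λ (u , v) (x , y) → u G.~ x ⊎ (u ≡ x × v H.~ y)
  ; _~?_     = λ (u , v) (x , y) →
                 (u G.~? x) ⊎-dec (≡-dec G.enum u x ×-dec (v H.~? y))
  ; ~-sym    = Sum.map G.~-sym λ (u≡x , v~y) → sym u≡x , H.~-sym v~y
  ; ~-irrefl = λ { refl (inj₁ u~u)       → G.~-irrefl refl u~u
                 ; refl (inj₂ (_ , v~v)) → H.~-irrefl refl v~v }
  }
  where
  module G = Graph G
  module H = Graph H

{-# OPTIONS --safe #-}

-- Let D be an efficient open dominating set. The open neighbourhoods of D
-- partition V(G), which gives γₜ(G) = |D|. A star at a vertex of minimum degree
-- in each H-layer over D (2 at the centre, 1 at the leaves) is a PRDF of weight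
-- |D| (2 + δ).
--
-- Conversely, let W(u) be the weight of a PRDF on N(u) × V(H). If N(u) × V(H)
-- contains exactly one 2, its layer already has weight at least 2 + δ. If it
-- contains several, the layer over u has no zero; if it contains none, the layer
-- over u must be dominated from within, unless it has no zero. As |V(H)| is
-- large, in every case W(u) ≥ 2 + δ or W(u) + W(v) ≥ 2 (2 + δ) for any
-- neighbour v of u. Hence W(u) + W(v) ≥ 2 (2 + δ) along every edge, and since D
-- induces a perfect matching, the sum of W over D, which is the weight of the
-- PRDF, is at least |D| (2 + δ).

module Submission where

open import Defs
open import Data.Nat.Base using (_+_; _*_; _≥_)
open import Relation.Binary.PropositionalEquality using (_≡_)

open import Algebra.Properties.Semiring.Sum using (*-distribˡ-sum)
open import Data.Bool.Base using (Bool; true; false; T; if_then_else_)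
open import Data.Bool.Properties using (T?)
open import Data.Fin.Base using (Fin; zero; suc; toℕ; combine; _↑ˡ_; _↑ʳ_)
open import Data.Fin.Patterns using (0F; 1F; 2F)
import Data.Fin.Properties as Fin
open import Data.List.Base using (map)
open import Data.List.Extrema.Nat using (min≤xs; xs≤max; argmin-sel)
import Data.List.Membership.Propositional as List
open import Data.List.Membership.Propositional.Properties
  using (∈-map⁺; ∈-map⁻; ∈-tabulate⁺)
import Data.List.Relation.Unary.All as All
open import Data.Nat.Base using (ℕ; zero; suc; _≤_; z≤n; s≤s; s≤s⁻¹)
import Data.Nat.Properties as ℕ
open import Algebra.Properties.CommutativeMonoid.Sum ℕ.+-0-commutativeMonoid
  using (sum; sum-cong-≗; ∑-distrib-+; ∑-comm; sum-replicate-zero)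
open import Data.Product.Base using (∃; _×_; _,_; proj₁; proj₂)
open import Data.Sum.Base using (_⊎_; inj₁; inj₂)
open import Data.Unit.Base using (tt)
open import Function.Base using (_∘_; id)
open import Function.Bundles using (Inverse)
open import Relation.Binary.Definitions using (DecidableEquality)
open import Relation.Binary.PropositionalEquality
  using (_≢_; refl; sym; trans; cong; cong₂; subst; module ≡-Reasoning)
open import Relation.Nullary.Decidable
  using (yes; no; ⌊_⌋; toWitness; fromWitness; ¬?; _×-dec_)
open import Relation.Nullary.Negation.Core using (¬_; contradiction)

-- Indicators and finite sums.

𝟙 : Bool → ℕ
𝟙 b = if b then 1 else 0

𝟙-true : ∀ {b} → T b → 𝟙 b ≡ 1
𝟙-true {true} _ = refl

𝟙-false : ∀ {b} → ¬ T b → 𝟙 b ≡ 0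
𝟙-false {true}  ¬b = contradiction tt ¬b
𝟙-false {false} _  = refl

sum-mono-≤ : ∀ {n} {f g : Fin n → ℕ} → (∀ i → f i ≤ g i) →
             sum f ≤ sum g
sum-mono-≤ {zero}  _   = z≤n
sum-mono-≤ {suc n} f≤g = ℕ.+-mono-≤ (f≤g zero) (sum-mono-≤ (f≤g ∘ suc))

sum-one : ∀ n → sum {n} (λ _ → 1) ≡ n
sum-one zero    = refl
sum-one (suc n) = cong suc (sum-one n)

sum-single : ∀ {n} {f : Fin n → ℕ} i → (∀ j → j ≢ i → f j ≡ 0) →
             sum f ≡ f i
sum-single {suc n} {f} zero f≡0 = trans
  (cong (f zero +_) (trans
    (sum-cong-≗ (λ j → f≡0 (suc j) λ ()))
    (sum-replicate-zero n)))
  (ℕ.+-identityʳ _)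
sum-single {suc n} (suc i) f≡0 = cong₂ _+_
  (f≡0 zero λ ())
  (sum-single i (λ j j≢i → f≡0 (suc j) (j≢i ∘ Fin.suc-injective)))

sum-++ : ∀ m {n} (f : Fin (m + n) → ℕ) →
         sum f ≡
         sum (f ∘ (_↑ˡ n)) + sum (f ∘ (m ↑ʳ_))
sum-++ zero    f = refl
sum-++ (suc m) f = trans (cong (f zero +_) (sum-++ m (f ∘ suc)))
                         (sym (ℕ.+-assoc (f zero) _ _))

sum-combine : ∀ m {n} (f : Fin (m * n) → ℕ) →
              sum f ≡
              sum (λ (i : Fin m) →
                sum (λ (j : Fin n) → f (combine i j)))
sum-combine zero        f = refl
sum-combine (suc m) {n} f = trans (sum-++ n f)
  (cong (sum (f ∘ (_↑ˡ m * n)) +_) (sum-combine m (f ∘ (n ↑ʳ_))))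

-- Sums over the vertices of a graph, and extreme degrees.

module _ (Γ : Graph) where
  open Graph Γ

  infix 4 _≟_
  _≟_ : DecidableEquality V
  _≟_ = ≡-dec enum

  to-injective : ∀ {i j} → Inverse.to enum i ≡ Inverse.to enum j → i ≡ j
  to-injective {i} {j} eq =
    trans (sym (strictlyInverseʳ i)) (trans (cong from eq) (strictlyInverseʳ j))
    where open Inverse enum

  ∑-mono-≤ : ∀ {f g} → (∀ v → f v ≤ g v) → ∑ Γ f ≤ ∑ Γ g
  ∑-mono-≤ f≤g = sum-mono-≤ (f≤g ∘ Inverse.to enum)

  ∑-+ : ∀ f g → ∑ Γ (λ v → f v + g v) ≡ ∑ Γ f + ∑ Γ g
  ∑-+ f g = ∑-distrib-+ (f ∘ Inverse.to enum) (g ∘ Inverse.to enum)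

  *-∑ : ∀ c f → c * ∑ Γ f ≡ ∑ Γ (λ v → c * f v)
  *-∑ c f = *-distribˡ-sum ℕ.+-*-semiring c (f ∘ Inverse.to enum)

  ∑-one : ∑ Γ (λ _ → 1) ≡ order
  ∑-one = sum-one order

  ∑-single : ∀ {f} v → (∀ u → u ≢ v → f u ≡ 0) → ∑ Γ f ≡ f v
  ∑-single {f} v f≡0 = trans
    (sum-single (from v) λ j j≢ → f≡0 (to j) λ to-j≡v →
      j≢ (to-injective (trans to-j≡v (sym (strictlyInverseˡ v)))))
    (cong f (strictlyInverseˡ v))
    where open Inverse enum

  -- Turns the contribution of one vertex into a sum over all vertices, so that later bounds can be
  -- checked pointwise.
  ∑-𝟙≟ : ∀ v c → ∑ Γ (λ u → 𝟙 ⌊ u ≟ v ⌋ * c) ≡ c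
  ∑-𝟙≟ v c = trans
    (∑-single v (λ u u≢v → cong (_* c) (𝟙-false (u≢v ∘ toWitness {a? = u ≟ v}))))
    (trans (cong (_* c) (𝟙-true (fromWitness {a? = v ≟ v} refl))) (ℕ.*-identityˡ c))

  term≤∑ : ∀ f v → f v ≤ ∑ Γ f
  term≤∑ f v = subst (_≤ ∑ Γ f) (∑-𝟙≟ v (f v)) (∑-mono-≤ bound)
    where
    bound : ∀ u → 𝟙 ⌊ u ≟ v ⌋ * f v ≤ f u
    bound u with u ≟ v
    ... | yes refl = ℕ.≤-reflexive (ℕ.*-identityˡ _)
    ... | no  _    = z≤n

  terms≤∑ : ∀ f {u v} → u ≢ v → f u + f v ≤ ∑ Γ f
  terms≤∑ f {u} {v} u≢v = subst (_≤ ∑ Γ f)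
    (trans (∑-+ (λ x → 𝟙 ⌊ x ≟ u ⌋ * f u) (λ x → 𝟙 ⌊ x ≟ v ⌋ * f v)) (cong₂ _+_ (∑-𝟙≟ u (f u)) (∑-𝟙≟ v (f v))))
    (∑-mono-≤ bound)
    where
    bound : ∀ x → 𝟙 ⌊ x ≟ u ⌋ * f u + 𝟙 ⌊ x ≟ v ⌋ * f v ≤ f x
    bound x with x ≟ u | x ≟ v
    ... | yes refl | yes refl = contradiction refl u≢v
    ... | yes refl | no _     = ℕ.≤-reflexive (trans (ℕ.+-identityʳ _) (ℕ.*-identityˡ _))
    ... | no _     | yes refl = ℕ.≤-reflexive (ℕ.*-identityˡ _)
    ... | no _     | no _     = z≤n

  ∈N⁺ : ∀ {u v} → u ~ v → v ∈ N Γ u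
  ∈N⁺ {u} {v} = fromWitness {a? = u ~? v}

  ∈N⁻ : ∀ {u v} → v ∈ N Γ u → u ~ v
  ∈N⁻ {u} {v} = toWitness {a? = u ~? v}

  ∈vertices : ∀ v → v List.∈ vertices Γ
  ∈vertices v = subst (List._∈ vertices Γ) (strictlyInverseˡ v) (∈-tabulate⁺ (from v))
    where open Inverse enum

  δ≤degree : ∀ v → δ Γ ≤ degree Γ v
  δ≤degree v = All.lookup (min≤xs _ _) (∈-map⁺ (degree Γ) (∈vertices v))

  degree≤Δ : ∀ v → degree Γ v ≤ Δ Γ
  degree≤Δ v = All.lookup (xs≤max (degree Γ vertex) _) (∈-map⁺ (degree Γ) (∈vertices v))

  δ-attained : ∃ λ v → degree Γ v ≡ δ Γ
  δ-attained with argmin-sel id (degree Γ vertex) (map (degree Γ) (vertices Γ))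
  -- The minimum is either the default bound or a list entry; the default is itself the degree of
  -- `vertex`.
  ... | inj₁ δ≡ = vertex , sym δ≡
  ... | inj₂ δ∈ with ∈-map⁻ (degree Γ) δ∈
  ...   | v , _ , δ≡ = v , sym δ≡

∑-swap : ∀ Γ Γ′ (f : Graph.V Γ → Graph.V Γ′ → ℕ) →
         ∑ Γ (λ u → ∑ Γ′ (f u)) ≡ ∑ Γ′ (λ v → ∑ Γ (λ u → f u v))
∑-swap Γ Γ′ f = ∑-comm {order Γ} {order Γ′}
  λ i j → f (Inverse.to (enum Γ) i) (Inverse.to (enum Γ′) j)
  where open Graph

-- The product is enumerated through `remQuot`, which `combine` inverts, so splitting the index
-- range splits the sum into layers.
∑-∘ₗ : ∀ G H f → ∑ (G ∘ₗ H) f ≡ ∑ G (λ u → ∑ H (λ v → f (u , v)))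
∑-∘ₗ G H f = trans (sum-combine G.order _)
  (sum-cong-≗ λ i → sum-cong-≗ λ j →
    cong (λ (i , j) → f (Inverse.to G.enum i , Inverse.to H.enum j)) (Fin.remQuot-combine i j))
  where
  module G = Graph G
  module H = Graph H

-- Both domination numbers are defined by a search; this evaluates them at an explicit minimiser
-- from the specification alone.
minimum-unique : ∀ {A : Set} {P : A → Set} {w k} →
                 IsMinimum P w k → ∀ x → P x → (∀ y → P y → w x ≤ w y) → k ≡ w x
minimum-unique ((y , py , refl) , least) x px x≤ = ℕ.≤-antisym (least x px) (x≤ y py)

-- Counting with an efficient open dominating set.

module _ (G : Graph) (D : VertexSet G) (eod : IsEfficientOpenDominating G D) where
  open Graph G

  private
    cover    = proj₁ eod
    disjoint = proj₂ eod

  dominator-unique : ∀ {u v x} → u ∈ D → v ∈ D → u ~ x → v ~ x → u ≡ v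
  dominator-unique {u} {v} {x} u∈D v∈D u~x v~x with _≟_ G u v
  ... | yes u≡v = u≡v
  ... | no  u≢v = contradiction (∈N⁺ G u~x , ∈N⁺ G v~x) (disjoint u v u∈D v∈D u≢v x)

  -- Covering supplies one nonzero term, and disjointness of the neighbourhoods makes every other
  -- term vanish.
  ∑-dominators : ∀ x → ∑ G (λ u → 𝟙 (D u) * 𝟙 (N G u x)) ≡ 1
  ∑-dominators x with cover x
  ... | u , u∈D , x∈Nu = trans (∑-single G u others)
                               (cong₂ _*_ (𝟙-true u∈D) (𝟙-true x∈Nu))
    where
    others : ∀ v → v ≢ u → 𝟙 (D v) * 𝟙 (N G v x) ≡ 0
    others v v≢u with T? (D v)
    ... | no  v∉D = cong (_* 𝟙 (N G v x)) (𝟙-false v∉D)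
    ... | yes v∈D = trans
      (cong (𝟙 (D v) *_) (𝟙-false λ x∈Nv →
        v≢u (dominator-unique v∈D u∈D (∈N⁻ G x∈Nv) (∈N⁻ G x∈Nu))))
      (ℕ.*-zeroʳ (𝟙 (D v)))

  -- After exchanging the sums, each `w x` is counted once for every dominator of `x` in `D`, hence
  -- exactly once.
  ∑-partition : ∀ (w : V → ℕ) → ∑ G (λ u → 𝟙 (D u) * ∑ G (λ x → 𝟙 (N G u x) * w x)) ≡ ∑ G w
  ∑-partition w = begin
    ∑ G (λ u → 𝟙 (D u) * ∑ G (λ x → 𝟙 (N G u x) * w x))
      ≡⟨ ∑-cong G (λ u → *-∑ G (𝟙 (D u)) (λ x → 𝟙 (N G u x) * w x)) ⟩
    ∑ G (λ u → ∑ G (λ x → 𝟙 (D u) * (𝟙 (N G u x) * w x)))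
      ≡⟨ ∑-swap G G (λ u x → 𝟙 (D u) * (𝟙 (N G u x) * w x)) ⟩
    ∑ G (λ x → ∑ G (λ u → 𝟙 (D u) * (𝟙 (N G u x) * w x)))
      ≡⟨ ∑-cong G inner ⟩
    ∑ G w ∎
    where
    open ≡-Reasoning

    inner : ∀ x → ∑ G (λ u → 𝟙 (D u) * (𝟙 (N G u x) * w x)) ≡ w x
    inner x = begin
      ∑ G (λ u → 𝟙 (D u) * (𝟙 (N G u x) * w x))
        ≡⟨ ∑-cong G (λ u → trans (sym (ℕ.*-assoc (𝟙 (D u)) (𝟙 (N G u x)) (w x)))
                                 (ℕ.*-comm (𝟙 (D u) * 𝟙 (N G u x)) (w x))) ⟩
      ∑ G (λ u → w x * (𝟙 (D u) * 𝟙 (N G u x)))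
        ≡⟨ *-∑ G (w x) (λ u → 𝟙 (D u) * 𝟙 (N G u x)) ⟨
      w x * ∑ G (λ u → 𝟙 (D u) * 𝟙 (N G u x))
        ≡⟨ cong (w x *_) (∑-dominators x) ⟩
      w x * 1
        ≡⟨ ℕ.*-identityʳ (w x) ⟩
      w x ∎

  ∑-constant-on-D : ∀ c → ∑ G (λ u → 𝟙 (D u) * c) ≡ size G D * c
  ∑-constant-on-D c = begin
    ∑ G (λ u → 𝟙 (D u) * c) ≡⟨ ∑-cong G (λ u → ℕ.*-comm (𝟙 (D u)) c) ⟩
    ∑ G (λ u → c * 𝟙 (D u)) ≡⟨ *-∑ G c (𝟙 ∘ D) ⟨
    c * size G D            ≡⟨ ℕ.*-comm c (size G D) ⟩
    size G D * c            ∎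
    where open ≡-Reasoning

  efficient⇒total : IsTotalDominating G D
  efficient⇒total v with cover v
  ... | u , u∈D , v∈Nu = u , ~-sym (∈N⁻ G v∈Nu) , u∈D

  -- The neighbourhoods of the vertices of `D` are disjoint and each meets `S`.
  efficient⇒minimum : ∀ S → IsTotalDominating G S → size G D ≤ size G S
  efficient⇒minimum S total = begin
    size G D
      ≡⟨ ∑-cong G (λ u → sym (ℕ.*-identityʳ (𝟙 (D u)))) ⟩
    ∑ G (λ u → 𝟙 (D u) * 1)
      ≤⟨ ∑-mono-≤ G (λ u → ℕ.*-monoʳ-≤ (𝟙 (D u)) (neighbour-in-S u)) ⟩
    ∑ G (λ u → 𝟙 (D u) * ∑ G (λ x → 𝟙 (N G u x) * 𝟙 (S x)))
      ≡⟨ ∑-partition (𝟙 ∘ S) ⟩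
    size G S ∎
    where
    open ℕ.≤-Reasoning

    neighbour-in-S : ∀ u → 1 ≤ ∑ G (λ x → 𝟙 (N G u x) * 𝟙 (S x))
    neighbour-in-S u with total u
    ... | x , u~x , x∈S = ℕ.≤-trans
      (ℕ.≤-reflexive (sym (cong₂ _*_ (𝟙-true (∈N⁺ G u~x)) (𝟙-true x∈S))))
      (term≤∑ G (λ x → 𝟙 (N G u x) * 𝟙 (S x)) x)

  -- Summing the edge bound over the matching that D induces counts every a u with
  -- u in D twice; across u stands for a at the partner of u.
  ∑-edge-bound : ∀ (a : V → ℕ) c → (∀ {u v} → u ~ v → 2 * c ≤ a u + a v) →
                 size G D * c ≤ ∑ G (λ u → 𝟙 (D u) * a u)
  ∑-edge-bound a c edge = ℕ.*-cancelˡ-≤ 2 (begin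
    2 * (size G D * c)
      ≡⟨ trans (sym (ℕ.*-assoc 2 (size G D) c))
               (trans (cong (_* c) (ℕ.*-comm 2 (size G D))) (ℕ.*-assoc (size G D) 2 c)) ⟩
    size G D * (2 * c)
      ≡⟨ ∑-constant-on-D (2 * c) ⟨
    ∑ G (λ u → 𝟙 (D u) * (2 * c))
      ≤⟨ ∑-mono-≤ G (λ u → ℕ.*-monoʳ-≤ (𝟙 (D u)) (edge-at u)) ⟩
    ∑ G (λ u → 𝟙 (D u) * (a u + across u))
      ≡⟨ ∑-cong G (λ u → ℕ.*-distribˡ-+ (𝟙 (D u)) (a u) (across u)) ⟩
    ∑ G (λ u → a-on-D u + 𝟙 (D u) * across u)
      ≡⟨ ∑-+ G a-on-D (λ u → 𝟙 (D u) * across u) ⟩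
    ∑ G a-on-D + ∑ G (λ u → 𝟙 (D u) * across u)
      ≡⟨ cong (∑ G a-on-D +_) (∑-partition a-on-D) ⟩
    ∑ G a-on-D + ∑ G a-on-D
      ≡⟨ cong (∑ G a-on-D +_) (ℕ.+-identityʳ (∑ G a-on-D)) ⟨
    2 * ∑ G a-on-D ∎)
    where
    open ℕ.≤-Reasoning

    a-on-D across : V → ℕ
    a-on-D u = 𝟙 (D u) * a u
    across u = ∑ G (λ x → 𝟙 (N G u x) * a-on-D x)

    edge-at : ∀ u → 2 * c ≤ a u + across u
    edge-at u with efficient⇒total u
    ... | v , u~v , v∈D = ℕ.≤-trans (edge u~v) (ℕ.+-monoʳ-≤ (a u) (begin
      a v
        ≡⟨ trans (ℕ.*-identityˡ (1 * a v)) (ℕ.*-identityˡ (a v)) ⟨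
      1 * (1 * a v)
        ≡⟨ cong₂ _*_ (𝟙-true (∈N⁺ G u~v)) (cong (_* a v) (𝟙-true v∈D)) ⟨
      𝟙 (N G u v) * a-on-D v
        ≤⟨ term≤∑ G (λ x → 𝟙 (N G u x) * a-on-D x) v ⟩
      across u ∎))

-- Weights of layers and of neighbourhoods.

module _ (G H : Graph) (f : Graph.V (G ∘ₗ H) → Fin 3) where
  private
    module G  = Graph G
    module H  = Graph H
    module GH = Graph (G ∘ₗ H)

  layerWeight : G.V → ℕ
  layerWeight x = ∑ H (λ y → toℕ (f (x , y)))

  -- The quantity W(u) of the overview.
  nbhdWeight : G.V → ℕ
  nbhdWeight u = ∑ G (λ x → 𝟙 (N G u x) * layerWeight x)

  layerWeight≤nbhdWeight : ∀ {u x} → u G.~ x → layerWeight x ≤ nbhdWeight u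
  layerWeight≤nbhdWeight {u} {x} u~x = begin
    layerWeight x                  ≡⟨ ℕ.*-identityˡ _ ⟨
    1 * layerWeight x              ≡⟨ cong (_* layerWeight x) (𝟙-true (∈N⁺ G u~x)) ⟨
    𝟙 (N G u x) * layerWeight x    ≤⟨ term≤∑ G (λ x → 𝟙 (N G u x) * layerWeight x) x ⟩
    nbhdWeight u                   ∎
    where open ℕ.≤-Reasoning

  layerWeights≤nbhdWeight : ∀ {u x z} → u G.~ x → u G.~ z → x ≢ z →
                            layerWeight x + layerWeight z ≤ nbhdWeight u
  layerWeights≤nbhdWeight {u} {x} {z} u~x u~z x≢z = begin
    layerWeight x + layerWeight z
      ≡⟨ cong₂ _+_ (ℕ.*-identityˡ (layerWeight x)) (ℕ.*-identityˡ (layerWeight z)) ⟨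
    1 * layerWeight x + 1 * layerWeight z
      ≡⟨ cong₂ (λ i j → i * layerWeight x + j * layerWeight z)
               (𝟙-true (∈N⁺ G u~x)) (𝟙-true (∈N⁺ G u~z)) ⟨
    𝟙 (N G u x) * layerWeight x + 𝟙 (N G u z) * layerWeight z
      ≤⟨ terms≤∑ G (λ x → 𝟙 (N G u x) * layerWeight x) x≢z ⟩
    nbhdWeight u ∎
    where open ℕ.≤-Reasoning

  positive : ∀ {p} → f p ≢ 0F → 1 ≤ toℕ (f p)
  positive {p} fp≢0 with f p
  ... | 0F = contradiction refl fp≢0
  ... | 1F = s≤s z≤n
  ... | 2F = s≤s z≤n

  two≤layerWeight : ∀ {x h} → f (x , h) ≡ 2F → 2 ≤ layerWeight x
  two≤layerWeight {x} {h} fxh≡2 = subst (_≤ layerWeight x) (cong toℕ fxh≡2)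
    (term≤∑ H (λ y → toℕ (f (x , y))) h)

  order≤layerWeight : ∀ {x} → (∀ y → f (x , y) ≢ 0F) → H.order ≤ layerWeight x
  order≤layerWeight {x} nonzero =
    subst (_≤ layerWeight x) (∑-one H) (∑-mono-≤ H λ y → positive (nonzero y))

  -- The 2 at `h` and the nonzero entries at its neighbours, at least δ in number, occupy different
  -- positions since `h` is not adjacent to itself.
  2+δ≤layerWeight : ∀ {x h} → f (x , h) ≡ 2F → (∀ {y} → h H.~ y → f (x , y) ≢ 0F) →
                    2 + δ H ≤ layerWeight x
  2+δ≤layerWeight {x} {h} fxh≡2 nonzero = begin
    2 + δ H                                          ≤⟨ ℕ.+-monoʳ-≤ 2 (δ≤degree H h) ⟩
    2 + degree H h                                   ≡⟨ cong (_+ degree H h) (∑-𝟙≟ H h 2) ⟨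
    ∑ H (λ y → 𝟙 ⌊ _≟_ H y h ⌋ * 2) + degree H h     ≡⟨ ∑-+ H (λ y → 𝟙 ⌊ _≟_ H y h ⌋ * 2) (𝟙 ∘ N H h) ⟨
    ∑ H (λ y → 𝟙 ⌊ _≟_ H y h ⌋ * 2 + 𝟙 (N H h y))    ≤⟨ ∑-mono-≤ H bound ⟩
    layerWeight x                                    ∎
    where
    open ℕ.≤-Reasoning

    bound : ∀ y → 𝟙 ⌊ _≟_ H y h ⌋ * 2 + 𝟙 (N H h y) ≤ toℕ (f (x , y))
    bound y with _≟_ H y h | h H.~? y
    ... | yes refl | yes h~h = contradiction h~h (H.~-irrefl refl)
    ... | yes refl | no  _   = ℕ.≤-reflexive (sym (cong toℕ fxh≡2))
    ... | no  _    | yes h~y = positive (nonzero h~y)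
    ... | no  _    | no  _   = z≤n

  -- All zeros of row `x` lie in N(h), so there are at most Δ of them. Every other entry contributes
  -- at least 1, and the 2 at `h` gives the extra unit.
  order<layerWeight+Δ : ∀ {x h} → f (x , h) ≡ 2F → (∀ {y} → f (x , y) ≡ 0F → h H.~ y) →
                        1 + H.order ≤ layerWeight x + Δ H
  order<layerWeight+Δ {x} {h} fxh≡2 zero⇒~ = begin
    1 + H.order                                 ≡⟨ cong₂ _+_ (∑-𝟙≟ H h 1) (∑-one H) ⟨
    ∑ H (λ y → 𝟙 ⌊ _≟_ H y h ⌋ * 1) + ∑ H (λ _ → 1)
                                                ≡⟨ ∑-+ H (λ y → 𝟙 ⌊ _≟_ H y h ⌋ * 1) (λ _ → 1) ⟨
    ∑ H (λ y → 𝟙 ⌊ _≟_ H y h ⌋ * 1 + 1)         ≤⟨ ∑-mono-≤ H bound ⟩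
    ∑ H (λ y → toℕ (f (x , y)) + 𝟙 (N H h y))   ≡⟨ ∑-+ H (λ y → toℕ (f (x , y))) (𝟙 ∘ N H h) ⟩
    layerWeight x + degree H h                  ≤⟨ ℕ.+-monoʳ-≤ (layerWeight x) (degree≤Δ H h) ⟩
    layerWeight x + Δ H                         ∎
    where
    open ℕ.≤-Reasoning

    bound : ∀ y → 𝟙 ⌊ _≟_ H y h ⌋ * 1 + 1 ≤ toℕ (f (x , y)) + 𝟙 (N H h y)
    bound y with _≟_ H y h | h H.~? y
    ... | yes refl | _       = ℕ.≤-trans (ℕ.≤-reflexive (sym (cong toℕ fxh≡2))) (ℕ.m≤m+n _ _)
    ... | no  _    | yes _   = ℕ.m≤n+m 1 _
    ... | no  _    | no  h≁y = ℕ.≤-trans (positive (h≁y ∘ zero⇒~)) (ℕ.m≤m+n _ _)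

  -- Lower bound for perfect Roman dominating functions.

  module _ (large : H.order ≥ Δ H + 2 * δ H + 3) (prdf : IsPRDF (G ∘ₗ H) f) where

    two-unique : ∀ {p q r} → f p ≡ 0F → p GH.~ q → f q ≡ 2F → p GH.~ r → f r ≡ 2F → q ≡ r
    two-unique fp≡0 p~q fq≡2 p~r fr≡2 with prdf _ fp≡0
    ... | _ , _ , unique = trans (sym (unique (p~q , fq≡2))) (unique (p~r , fr≡2))

    -- Even with Δ dropped from `large`, the constant 3 and the added 1 make up the 4 in 4 + 2δ.
    2*[2+δ]≤1+order : 2 * (2 + δ H) ≤ 1 + H.order
    2*[2+δ]≤1+order = begin
      2 * (2 + δ H)            ≡⟨ ℕ.*-distribˡ-+ 2 2 (δ H) ⟩
      4 + 2 * δ H              ≡⟨ ℕ.+-comm 4 (2 * δ H) ⟩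
      2 * δ H + 4              ≡⟨ ℕ.+-suc (2 * δ H) 3 ⟩
      1 + (2 * δ H + 3)        ≤⟨ s≤s (ℕ.m≤n+m _ (Δ H)) ⟩
      1 + (Δ H + (2 * δ H + 3)) ≡⟨ cong suc (ℕ.+-assoc (Δ H) (2 * δ H) 3) ⟨
      1 + (Δ H + 2 * δ H + 3)  ≤⟨ s≤s large ⟩
      1 + H.order              ∎
      where open ℕ.≤-Reasoning

    2+δ≤order : 2 + δ H ≤ H.order
    2+δ≤order = s≤s⁻¹ (begin
      3 + δ H                  ≤⟨ ℕ.+-mono-≤ (ℕ.n≤1+n 3) (ℕ.m≤m+n (δ H) _) ⟩
      4 + 2 * δ H              ≡⟨ ℕ.*-distribˡ-+ 2 2 (δ H) ⟨
      2 * (2 + δ H)            ≤⟨ 2*[2+δ]≤1+order ⟩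
      1 + H.order              ∎)
      where open ℕ.≤-Reasoning

    -- Zeros confined to N(h) cost at most Δ, and `large` makes |V(H)| + 1 - Δ at least 2δ + 4.
    2*[2+δ]≤layerWeight : ∀ {x h} → f (x , h) ≡ 2F → (∀ {y} → f (x , y) ≡ 0F → h H.~ y) →
                          2 * (2 + δ H) ≤ layerWeight x
    2*[2+δ]≤layerWeight {x} fxh≡2 zero⇒~ = ℕ.+-cancelʳ-≤ (Δ H) _ _ (begin
      2 * (2 + δ H) + Δ H      ≡⟨ cong (_+ Δ H) (ℕ.*-distribˡ-+ 2 2 (δ H)) ⟩
      4 + 2 * δ H + Δ H        ≡⟨ cong (4 +_) (ℕ.+-comm (2 * δ H) (Δ H)) ⟩
      4 + (Δ H + 2 * δ H)      ≡⟨ cong suc (ℕ.+-comm 3 (Δ H + 2 * δ H)) ⟩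
      1 + (Δ H + 2 * δ H + 3)  ≤⟨ s≤s large ⟩
      1 + H.order              ≤⟨ order<layerWeight+Δ fxh≡2 zero⇒~ ⟩
      layerWeight x + Δ H      ∎)
      where open ℕ.≤-Reasoning

    -- A zero in row x adjacent to (x , h) leaves no 2 in the rows over N(x), so
    -- that all zeros of row x are adjacent to (x , h).
    single-two⇒2+δ≤layerWeight : ∀ {x h} → f (x , h) ≡ 2F → (∀ {y} → f (x , y) ≡ 2F → y ≡ h) →
                                 2 + δ H ≤ layerWeight x
    single-two⇒2+δ≤layerWeight {x} {h} fxh≡2 only
      with any? H.enum (λ y → (h H.~? y) ×-dec (f (x , y) Fin.≟ 0F))
    ... | no none = 2+δ≤layerWeight fxh≡2 (λ h~y fxy≡0 → none (_ , h~y , fxy≡0))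
    ... | yes (y , h~y , fxy≡0) =
      ℕ.≤-trans (ℕ.m≤n*m (2 + δ H) 2) (2*[2+δ]≤layerWeight fxh≡2 zero⇒~)
      where
      zero⇒~ : ∀ {z} → f (x , z) ≡ 0F → h H.~ z
      zero⇒~ fxz≡0 with prdf _ fxz≡0
      ... | (x′ , k) , (inj₁ x~x′ , fx′k≡2) , _ = contradiction x~x′
        (G.~-irrefl (cong proj₁
          (two-unique fxy≡0 (inj₂ (refl , H.~-sym h~y)) fxh≡2 (inj₁ x~x′) fx′k≡2)))
      ... | (_ , k) , (inj₂ (refl , z~k) , fxk≡2) , _ with only fxk≡2
      ...   | refl = H.~-sym z~k

    -- The cases follow the number of 2s over N(u), then the number in row `u`. The second
    -- alternative is taken when the weight found lies partly or wholly over N(v).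
    nbhdWeight-dichotomy : ∀ {u v} → u G.~ v →
      2 + δ H ≤ nbhdWeight u ⊎ 2 * (2 + δ H) ≤ nbhdWeight u + nbhdWeight v
    nbhdWeight-dichotomy {u} {v} u~v
      with any? GH.enum (λ p → (u G.~? proj₁ p) ×-dec (f p Fin.≟ 2F))
    nbhdWeight-dichotomy {u} {v} u~v | yes ((x , h) , u~x , fxh≡2)
      with any? GH.enum (λ p → (u G.~? proj₁ p) ×-dec (f p Fin.≟ 2F) ×-dec ¬? (_≟_ (G ∘ₗ H) p (x , h)))
    ... | no none = inj₁ (ℕ.≤-trans
      (single-two⇒2+δ≤layerWeight fxh≡2 only) (layerWeight≤nbhdWeight u~x))
      where
      only : ∀ {y} → f (x , y) ≡ 2F → y ≡ h
      only {y} fxy≡2 with _≟_ H y h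
      ... | yes y≡h = y≡h
      ... | no  y≢h = contradiction ((x , y) , u~x , fxy≡2 , y≢h ∘ cong proj₂) none
    -- A zero of row `u` would see both 2s, so that row has none. Row `x` counts towards W(u) and
    -- row `u` towards W(v).
    ... | yes (p , u~p , fp≡2 , p≢xh) = inj₂ (begin
      2 * (2 + δ H)                  ≤⟨ 2*[2+δ]≤1+order ⟩
      1 + H.order                    ≤⟨ ℕ.n≤1+n _ ⟩
      2 + H.order                    ≤⟨ ℕ.+-mono-≤ (two≤layerWeight fxh≡2) (order≤layerWeight nonzero) ⟩
      layerWeight x + layerWeight u  ≤⟨ ℕ.+-mono-≤ (layerWeight≤nbhdWeight u~x)
                                                   (layerWeight≤nbhdWeight (G.~-sym u~v)) ⟩
      nbhdWeight u + nbhdWeight v    ∎)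
      where
      open ℕ.≤-Reasoning

      nonzero : ∀ y → f (u , y) ≢ 0F
      nonzero y fuy≡0 = p≢xh (two-unique fuy≡0 (inj₁ u~p) fp≡2 (inj₁ u~x) fxh≡2)
    nbhdWeight-dichotomy {u} {v} u~v | no noTwo
      with any? H.enum (λ h → f (u , h) Fin.≟ 2F)
    nbhdWeight-dichotomy {u} {v} u~v | no noTwo | yes (h , fuh≡2)
      with any? H.enum (λ k → (f (u , k) Fin.≟ 2F) ×-dec ¬? (_≟_ H k h))
    -- Two 2s in row `u` are both adjacent to all of row `v`, which therefore has no zero.
    ... | yes (k , fuk≡2 , k≢h) = inj₁ (ℕ.≤-trans 2+δ≤order (ℕ.≤-trans
      (order≤layerWeight nonzero) (layerWeight≤nbhdWeight u~v)))
      where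
      nonzero : ∀ y → f (v , y) ≢ 0F
      nonzero y fvy≡0 = k≢h (cong proj₂
        (two-unique fvy≡0 (inj₁ (G.~-sym u~v)) fuk≡2 (inj₁ (G.~-sym u~v)) fuh≡2))
    -- With no 2 over N(u), each zero of row `u` is dominated inside the row, where the only 2 is at
    -- `h`. Here W(v) alone suffices.
    ... | no none = inj₂ (ℕ.≤-trans (2*[2+δ]≤layerWeight fuh≡2 zero⇒~)
      (ℕ.≤-trans (layerWeight≤nbhdWeight (G.~-sym u~v)) (ℕ.m≤n+m _ _)))
      where
      zero⇒~ : ∀ {y} → f (u , y) ≡ 0F → h H.~ y
      zero⇒~ fuy≡0 with prdf _ fuy≡0
      ... | _ , (inj₁ u~z , fz≡2) , _ = contradiction (_ , u~z , fz≡2) noTwo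
      ... | (_ , k) , (inj₂ (refl , y~k) , fuk≡2) , _ with _≟_ H k h
      ...   | yes refl = H.~-sym y~k
      ...   | no  k≢h  = contradiction (k , fuk≡2 , k≢h) none
    nbhdWeight-dichotomy {u} {v} u~v | no noTwo | no noTwo-u
      with any? H.enum (λ y → f (v , y) Fin.≟ 0F)
    ... | no none = inj₁ (ℕ.≤-trans 2+δ≤order (ℕ.≤-trans
      (order≤layerWeight (λ y fvy≡0 → none (y , fvy≡0))) (layerWeight≤nbhdWeight u~v)))
    ... | yes (y , fvy≡0) with prdf _ fvy≡0
    ...   | (_ , k) , (inj₂ (refl , _) , fvk≡2) , _ = contradiction (_ , u~v , fvk≡2) noTwo
    -- Row `u` is adjacent to no 2 and contains none, so it has no zero, and the 2 dominating the
    -- zero of row `v` lies in another row `z`. Both rows count towards W(v).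
    ...   | (z , k) , (inj₁ v~z , fzk≡2) , _ = inj₂ (begin
      2 * (2 + δ H)                  ≤⟨ 2*[2+δ]≤1+order ⟩
      1 + H.order                    ≤⟨ ℕ.n≤1+n _ ⟩
      2 + H.order                    ≤⟨ ℕ.+-mono-≤ (two≤layerWeight fzk≡2) (order≤layerWeight nonzero) ⟩
      layerWeight z + layerWeight u  ≤⟨ layerWeights≤nbhdWeight v~z (G.~-sym u~v) z≢u ⟩
      nbhdWeight v                   ≤⟨ ℕ.m≤n+m _ _ ⟩
      nbhdWeight u + nbhdWeight v    ∎)
      where
      open ℕ.≤-Reasoning

      z≢u : z ≢ u
      z≢u refl = noTwo-u (k , fzk≡2)

      nonzero : ∀ y → f (u , y) ≢ 0F
      nonzero y fuy≡0 with prdf _ fuy≡0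
      ... | _ , (inj₁ u~x , fx≡2) , _ = noTwo (_ , u~x , fx≡2)
      ... | _ , (inj₂ (refl , _) , fu≡2) , _ = noTwo-u (_ , fu≡2)

    nbhdWeight-edge : ∀ {u v} → u G.~ v → 2 * (2 + δ H) ≤ nbhdWeight u + nbhdWeight v
    nbhdWeight-edge {u} {v} u~v
      with nbhdWeight-dichotomy u~v | nbhdWeight-dichotomy (G.~-sym u~v)
    ... | inj₂ both | _         = both
    ... | _         | inj₂ both = ℕ.≤-trans both (ℕ.≤-reflexive (ℕ.+-comm (nbhdWeight v) (nbhdWeight u)))
    ... | inj₁ at-u | inj₁ at-v = ℕ.+-mono-≤ at-u (ℕ.≤-trans (ℕ.≤-reflexive (ℕ.+-identityʳ _)) at-v)

    weight-lower-bound : ∀ D → IsEfficientOpenDominating G D →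
                         size G D * (2 + δ H) ≤ weight (G ∘ₗ H) f
    weight-lower-bound D eod = begin
      size G D * (2 + δ H)                ≤⟨ ∑-edge-bound G D eod nbhdWeight (2 + δ H) nbhdWeight-edge ⟩
      ∑ G (λ u → 𝟙 (D u) * nbhdWeight u)  ≡⟨ ∑-partition G D eod layerWeight ⟩
      ∑ G layerWeight                     ≡⟨ ∑-∘ₗ G H (toℕ ∘ f) ⟨
      weight (G ∘ₗ H) f                   ∎
      where open ℕ.≤-Reasoning

-- The star construction for the upper bound.

module _ (G H : Graph) (D : VertexSet G) (eod : IsEfficientOpenDominating G D)
         (h : Graph.V H) where
  private
    module G = Graph G
    module H = Graph H

  starFunction : Graph.V (G ∘ₗ H) → Fin 3
  starFunction (x , y) =
    if D x then (if ⌊ _≟_ H y h ⌋ then 2F else if N H h y then 1F else 0F) else 0F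

  -- Centre and leaves are disjoint, so the nested conditionals become a product of a factor in `x`
  -- and a factor in `y`, and the weight factorises.
  starFunction-formula : ∀ x y →
    toℕ (starFunction (x , y)) ≡ 𝟙 (D x) * (𝟙 ⌊ _≟_ H y h ⌋ * 2 + 𝟙 (N H h y))
  starFunction-formula x y with D x | _≟_ H y h | h H.~? y
  ... | false | _        | _       = refl
  ... | true  | yes refl | yes h~h = contradiction h~h (H.~-irrefl refl)
  ... | true  | yes refl | no  _   = refl
  ... | true  | no  _    | yes _   = refl
  ... | true  | no  _    | no  _   = refl

  starFunction-weight : weight (G ∘ₗ H) starFunction ≡ size G D * (2 + degree H h)
  starFunction-weight = begin
    weight (G ∘ₗ H) starFunction
      ≡⟨ ∑-∘ₗ G H (toℕ ∘ starFunction) ⟩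
    ∑ G (λ x → ∑ H (λ y → toℕ (starFunction (x , y))))
      ≡⟨ ∑-cong G (λ x → trans (∑-cong H (starFunction-formula x)) (sym (*-∑ H (𝟙 (D x)) row))) ⟩
    ∑ G (λ x → 𝟙 (D x) * ∑ H row)
      ≡⟨ ∑-constant-on-D G D eod (∑ H row) ⟩
    size G D * ∑ H row
      ≡⟨ cong (size G D *_) (trans
           (∑-+ H (λ y → 𝟙 ⌊ _≟_ H y h ⌋ * 2) (𝟙 ∘ N H h))
           (cong (_+ degree H h) (∑-𝟙≟ H h 2))) ⟩
    size G D * (2 + degree H h) ∎
    where
    open ≡-Reasoning

    row : H.V → ℕ
    row y = 𝟙 ⌊ _≟_ H y h ⌋ * 2 + 𝟙 (N H h y)

  starFunction-two⁺ : ∀ {x} → x ∈ D → starFunction (x , h) ≡ 2F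
  starFunction-two⁺ {x} x∈D with D x | _≟_ H h h
  ... | true | yes _   = refl
  ... | true | no  h≢h = contradiction refl h≢h

  starFunction-two⁻ : ∀ {x y} → starFunction (x , y) ≡ 2F → x ∈ D × y ≡ h
  starFunction-two⁻ {x} {y} eq with D x | _≟_ H y h | h H.~? y
  ... | true | yes y≡h | _ = tt , y≡h
  starFunction-two⁻ {x} {y} () | true | no _ | yes _
  starFunction-two⁻ {x} {y} () | true | no _ | no _

  starFunction-zero⁻ : ∀ {x y} → x ∈ D → starFunction (x , y) ≡ 0F → ¬ h H.~ y
  starFunction-zero⁻ {x} {y} x∈D eq h~y with D x | _≟_ H y h | h H.~? y
  ... | true | no _ | no h≁y = h≁y h~y

  -- The 2 seen by a zero in row `x` is the centre of the star over the unique dominator of `x` in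
  -- `D`.
  starFunction-prdf : IsPRDF (G ∘ₗ H) starFunction
  starFunction-prdf (x , y) xy≡0 with proj₁ eod x
  ... | u , u∈D , x∈Nu = (u , h) , (inj₁ (G.~-sym u~x) , starFunction-two⁺ u∈D) , unique
    where
    u~x = ∈N⁻ G x∈Nu

    unique : ∀ {q} → Graph._~_ (G ∘ₗ H) (x , y) q × starFunction q ≡ 2F → (u , h) ≡ q
    unique (adjacent , two) with starFunction-two⁻ two | adjacent
    ... | z∈D , refl | inj₁ x~z =
      cong (_, h) (dominator-unique G D eod u∈D z∈D u~x (G.~-sym x~z))
    -- A second 2 could only be the centre of the zero's own row, but its neighbours there carry 1.
    ... | x∈D , refl | inj₂ (refl , y~h) =
      contradiction (H.~-sym y~h) (starFunction-zero⁻ x∈D xy≡0)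

-- Equality of the two bounds.

theorem4p11 : (G H : Graph) (eod : EfficientOpenDomination G) →
    Graph.order H ≥ Δ H + 2 * δ H + 3 →
    γᵖR (G ∘ₗ H) ≡ γₜ G (efficientOpenDomination⇒noIsolatedVertices G eod) * (2 + δ H)
theorem4p11 G H (D , eod) large = begin
  γᵖR (G ∘ₗ H)
    ≡⟨ minimum-unique (proj₂ (perfect-Roman-domination-number-exists (G ∘ₗ H)))
         star (starFunction-prdf G H D eod h)
         (λ f prdf → subst (_≤ _) (sym star-weight) (weight-lower-bound G H f large prdf D eod)) ⟩
  weight (G ∘ₗ H) star
    ≡⟨ star-weight ⟩
  size G D * (2 + δ H)
    ≡⟨ cong (_* (2 + δ H)) (minimum-unique (proj₂ (total-domination-number-exists G _))
         D (efficient⇒total G D eod) (efficient⇒minimum G D eod)) ⟨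
  γₜ G (efficientOpenDomination⇒noIsolatedVertices G (D , eod)) * (2 + δ H) ∎
  where
  open ≡-Reasoning
  -- A centre of minimum degree makes the star weigh exactly 2 + δ, matching the lower bound.
  h    = proj₁ (δ-attained H)
  star = starFunction G H D eod h

  star-weight : weight (G ∘ₗ H) star ≡ size G D * (2 + δ H)
  star-weight = trans (starFunction-weight G H D eod h)
                      (cong (λ d → size G D * (2 + d)) (proj₂ (δ-attained H)))
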